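{- Let $p$ be an odd prime and let $B$ be a non-empty subset of $\mathbb Z_p$. (i) If $p\equiv 1\pmod 4$ and $0\notin B$, then $C_{Q_p,B}=6$. (ii) If $p\equiv 3\pmod 4$ and $B\subseteq Q_p$, then $C_{Q_p,B}=9$.
   Context: For an odd prime $p$, $\mathbb Z_p=\mathbb Z/p\mathbb Z$, $U(p)$ is its group of units, and $Q_p=\{x^2:x\in U(p)\}$. A sequence of length $k$ in $\mathbb Z_p$ is an element of $\mathbb Z_p^k$. For a non-empty $B\subseteq\mathbb Z_p$, a sequence $(x_1,\ldots,x_k)$ in $\mathbb Z_p$ is called a $(Q_p,B)$-weighted zero-sum sequence if there exist $a_1,\ldots,a_k\in Q_p$ and $b_1,\ldots,b_k\in B$ such that $a_1x_1+\cdots+a_kx_k=0$ and $b_1a_1+\cdots+b_ka_k=0$ in $\mathbb Z_p$. The constant $C_{Q_p,B}$ is the least positive integer $k$ such that every sequence in $\mathbb Z_p$ of length $k$ has a (non-empty) $(Q_p,B)$-weighted zero-sum subsequence consisting of consecutive terms. -}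

module Defs where

open import Algebra.Definitions using (Invertible)
open import Data.Fin.Base using (Fin; toℕ)
import Data.Nat.Base as ℕ
open ℕ using (ℕ; NonZero; _≤_; _<_)
open import Data.Nat.DivMod using (_mod_)
open import Data.List.Relation.Binary.Infix.Heterogeneous using (Infix)
open import Data.Product.Base using (Σ-syntax; ∃-syntax; _×_)
open import Data.Vec.Base using (Vec; foldr′; zipWith; toList)
open import Data.Vec.Relation.Unary.All using (All)
open import Level using (Level; 0ℓ)
open import Relation.Binary.PropositionalEquality.Core using (_≡_)
open import Relation.Unary using (Pred)

infixl 6 _+_
infixl 7 _*_

-- Each residue class is represented by its least non-negative element.
ℤ/_ : ℕ → Set
ℤ/ p = Fin p

0# 1# : {p : ℕ} .{{_ : NonZero p}} → ℤ/ p
0# {p} = 0 mod p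
1# {p} = 1 mod p

_+_ _*_ : {p : ℕ} .{{_ : NonZero p}} → ℤ/ p → ℤ/ p → ℤ/ p
_+_ {p} x y = (toℕ x ℕ.+ toℕ y) mod p
_*_ {p} x y = (toℕ x ℕ.* toℕ y) mod p

Unit : (p : ℕ) .{{_ : NonZero p}} → Pred (ℤ/ p) 0ℓ
Unit p = Invertible _≡_ 1# _*_

Q : (p : ℕ) .{{_ : NonZero p}} → Pred (ℤ/ p) 0ℓ
Q p y = ∃[ x ] Unit p x × y ≡ x * x

sum : {p k : ℕ} .{{_ : NonZero p}} → Vec (ℤ/ p) k → ℤ/ p
sum = foldr′ _+_ 0#

WeightedZeroSum : {p k : ℕ} .{{_ : NonZero p}} {a b : Level} →
                  Pred (ℤ/ p) a → Pred (ℤ/ p) b → Vec (ℤ/ p) k → Set _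
WeightedZeroSum {p} {k} A B xs =
  Σ[ as ∈ Vec (ℤ/ p) k ] Σ[ bs ∈ Vec (ℤ/ p) k ]
    All A as × All B bs ×
    sum (zipWith _*_ as xs) ≡ 0# × sum (zipWith _*_ bs as) ≡ 0#

-- The bound 0 < m matters: the empty sequence is vacuously a weighted
-- zero-sum sequence.
HasConsecutiveZeroSum : {p k : ℕ} .{{_ : NonZero p}} {a b : Level} →
                        Pred (ℤ/ p) a → Pred (ℤ/ p) b → Vec (ℤ/ p) k → Set _
HasConsecutiveZeroSum {p} A B xs =
  ∃[ m ] Σ[ ys ∈ Vec (ℤ/ p) m ]
    0 < m × Infix _≡_ (toList ys) (toList xs) × WeightedZeroSum A B ys

Forces : {p : ℕ} .{{_ : NonZero p}} {a b : Level} →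
         Pred (ℤ/ p) a → Pred (ℤ/ p) b → ℕ → Set _
Forces {p} A B k = (xs : Vec (ℤ/ p) k) → HasConsecutiveZeroSum A B xs

-- "C_{A,B} = k".  The constant is given as a relation because a function
-- computing it would need its existence, and decidability of A and B.
C⟨_,_⟩≡_ : {p : ℕ} .{{_ : NonZero p}} {a b : Level} →
           Pred (ℤ/ p) a → Pred (ℤ/ p) b → ℕ → Set _
C⟨ A , B ⟩≡ k =
  0 < k × Forces A B k × (∀ m → 0 < m → Forces A B m → k ≤ m)

{-# OPTIONS --safe #-}
module Submission where

-- Only a single b ∈ B is needed for the upper bound, where a window has to satisfy Σ aᵢ ≡ 0 and
-- Σ aᵢ xᵢ ≡ 0.  Fix weights w in Q of length k + 1 with sum 0 (k = 1: (1, -1); k = 2: any solution of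
-- q₁ + q₂ + q₃ ≡ 0) and cut the sequence into three blocks of length k + 1, with w-values s, t, u.
-- A vanishing value gives a window.  If -st is a square, then s and t cancel after scaling by squares;
-- likewise t and u.  Otherwise -st and -tu are both nonresidues, and since some nonresidue is a sum of
-- two squares, a s + b t + c u ≡ 0 is solvable in squares.  Hence 3 (k + 1) terms suffice.
-- Conversely, for a nonresidue n, in 0ᵏ 1 0ᵏ (-n) 0ᵏ any window with a zero weighted sum consists of
-- at most k zeros, and no non-empty weights of length ≤ k satisfy Σ bᵢ aᵢ ≡ 0.
-- The facts on residues follow from Dirichlet's pairing x ↔ c / x in the product of all units.

open import Defs
open import Algebra.Bundles using (CommutativeSemiring)
import Algebra.Properties.CommutativeSemiring.Exp as Exp
import Algebra.Solver.Ring.NaturalCoefficients.Default as SemiringSolver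
open import Algebra.Structures.Biased using (isCommutativeSemiringˡ)
open import Data.Empty using (⊥; ⊥-elim)
open import Data.Fin.Base using (Fin; toℕ)
import Data.Fin.Properties as Fin
open import Data.List.Base using (List; []; _∷_; _++_; foldr; length; applyUpTo)
open import Data.List.Membership.Propositional using (_∈_)
open import Data.List.Membership.Propositional.Properties using (∈-∃++; ∈-applyUpTo⁺; ∈-applyUpTo⁻)
open import Data.List.Properties using (length-applyUpTo)
open import Data.List.Relation.Binary.Infix.Heterogeneous using (Infix; here; there)
open import Data.List.Relation.Binary.Infix.Heterogeneous.Properties
  using (Infix-Prefix-trans; fromPointwise)
open import Data.List.Relation.Binary.Permutation.Propositional
  using (_↭_; ↭-sym; ↭-trans; prep; ↭⇒↭ₛ)
open import Data.List.Relation.Binary.Permutation.Propositional.Properties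
  using (shift; ∈-resp-↭; ↭-length)
import Data.List.Relation.Binary.Permutation.Setoid.Properties as Permutation
import Data.List.Relation.Binary.Pointwise as Pointwise
open import Data.List.Relation.Binary.Prefix.Heterogeneous using (Prefix; []; _∷_)
open import Data.List.Relation.Unary.All as ListAll using (_∷_)
open import Data.List.Relation.Unary.AllPairs using ([]; _∷_)
open import Data.List.Relation.Unary.Any using (here; there)
open import Data.List.Relation.Unary.Unique.Propositional using (Unique)
open import Data.List.Relation.Unary.Unique.Propositional.Properties using (applyUpTo⁺₁)
open import Data.Nat.Base as ℕ using (ℕ; zero; suc; NonZero; _%_; _/_; _≤_; _<_; s≤s; z≤n)
open import Data.Nat.Coprimality using (prime⇒coprime; coprime-Bézout)
open import Data.Nat.DivMod
  using (_mod_; m%n<n; n%n≡0; m*n%n≡0; m<n⇒m%n≡m; %-distribˡ-+; %-distribˡ-*; m≡m%n+[m/n]*n)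
open import Data.Nat.Divisibility using (_∣_; _∤_; >⇒∤; m%n≡0⇒n∣m)
open import Data.Nat.GCD using (module Bézout)
open import Data.Nat.Primality using (Prime; euclidsLemma; prime⇒nonTrivial)
import Data.Nat.Properties as ℕ
open import Data.Product.Base using (Σ-syntax; ∃; ∃₂; _×_; _,_; proj₁; proj₂)
open import Data.Sum.Base as Sum using (_⊎_; inj₁; inj₂; [_,_]′)
open import Data.Vec.Base as Vec using (Vec; []; _∷_; zipWith; toList; replicate; truncate)
open import Data.Vec.Relation.Unary.All as VecAll using (All; []; _∷_)
open import Data.Vec.Relation.Unary.All.Properties using (++⁺; map⁺)
open import Function.Base using (_∘_)
open import Function.Definitions using (Injective)
open import Level using (Level; 0ℓ)
open import Relation.Binary.PropositionalEquality
  using (_≡_; _≢_; refl; sym; trans; cong; cong₂; subst; subst₂; setoid; module ≡-Reasoning)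
open import Relation.Binary.PropositionalEquality.Algebra using (isMagma)
open import Relation.Nullary using (¬_; Dec; yes; no; contradiction)
open import Relation.Nullary.Decidable using (map′; _×-dec_; ¬?)
open import Relation.Unary using (Pred; Decidable; Satisfiable; _∉_; _⊆_)

-- Finite injections, lists, prefixes and infixes.

-- Punching out the missed value e would turn an injective f into an injection into a smaller `Fin`,
-- against the pigeonhole principle.
avoids⇒notInjective : ∀ {n} {f : Fin n → Fin n} (e : Fin n) → (∀ i → e ≢ f i) →
                      ¬ Injective _≡_ _≡_ f
avoids⇒notInjective {suc _} e e≢f f-injective =
  Fin.<⇒notInjective (ℕ.n<1+n _) λ eq → f-injective (Fin.punchOut-injective (e≢f _) (e≢f _) eq)

abstract
  extract : ∀ {a} {A : Set a} {x : A} {xs} → x ∈ xs → ∃ λ ys → xs ↭ x ∷ ys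
  extract x∈xs with ys , zs , refl ← ∈-∃++ x∈xs = ys ++ zs , shift _ ys zs

all-replicate : ∀ {a ℓ} {A : Set a} {P : Pred A ℓ} {x} m → P x → All P (replicate m x)
all-replicate zero    Px = []
all-replicate (suc m) Px = Px ∷ all-replicate m Px

module _ {a} {A : Set a} where

  infix-refl : (xs : List A) → Infix _≡_ xs xs
  infix-refl xs = fromPointwise (Pointwise.refl refl {xs})

  prefix-++ : ∀ {m n} (xs : Vec A m) (ys : Vec A n) → Prefix _≡_ (toList xs) (toList (xs Vec.++ ys))
  prefix-++ []       ys = []
  prefix-++ (x ∷ xs) ys = refl ∷ prefix-++ xs ys

  prefix-++ˡ : ∀ {l m n} (xs : Vec A l) {ys : Vec A m} {zs : Vec A n} →
               Prefix _≡_ (toList ys) (toList zs) →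
               Prefix _≡_ (toList (xs Vec.++ ys)) (toList (xs Vec.++ zs))
  prefix-++ˡ []       ys≤zs = ys≤zs
  prefix-++ˡ (x ∷ xs) ys≤zs = refl ∷ prefix-++ˡ xs ys≤zs

  infix-++ˡ : ∀ {m n} (xs : Vec A m) {ys : Vec A n} {zs} →
              Infix _≡_ zs (toList ys) → Infix _≡_ zs (toList (xs Vec.++ ys))
  infix-++ˡ []       zs≤ys = zs≤ys
  infix-++ˡ (x ∷ xs) zs≤ys = there (infix-++ˡ xs zs≤ys)

  prefix-truncate : ∀ {m n} (m≤n : m ≤ n) (xs : Vec A n) →
                    Prefix _≡_ (toList (truncate m≤n xs)) (toList xs)
  prefix-truncate z≤n       xs       = []
  prefix-truncate (s≤s m≤n) (x ∷ xs) = refl ∷ prefix-truncate m≤n xs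

-- Polynomial identities in a commutative semiring.

-- The solver has no negation: below, m is instantiated with -1.
module Identities {c ℓ} (R : CommutativeSemiring c ℓ) where

  open CommutativeSemiring R using (_≈_)
    renaming (1# to 𝟙; _+_ to infixl 6 _⊕_; _*_ to infixl 7 _⊗_; refl to ≈-refl)
  open SemiringSolver R using (solve; _:+_; _:*_; _:=_; con)

  m*x+x≈[m+1]*x : ∀ m x → m ⊗ x ⊕ x ≈ (m ⊕ 𝟙) ⊗ x
  m*x+x≈[m+1]*x = solve 2 (λ m x → m :* x :+ x := (m :+ con 1) :* x) ≈-refl

  x+x≈2*x : ∀ x → x ⊕ x ≈ (𝟙 ⊕ 𝟙) ⊗ x
  x+x≈2*x = solve 1 (λ x → x :+ x := (con 1 :+ con 1) :* x) ≈-refl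

  x*[i*y]≈i*x*y : ∀ x i y → x ⊗ (i ⊗ y) ≈ i ⊗ x ⊗ y
  x*[i*y]≈i*x*y = solve 3 (λ x i y → x :* (i :* y) := i :* x :* y) ≈-refl

  [x*y]²≈x²*y² : ∀ x y → x ⊗ y ⊗ (x ⊗ y) ≈ x ⊗ x ⊗ (y ⊗ y)
  [x*y]²≈x²*y² = solve 2 (λ x y → x :* y :* (x :* y) := x :* x :* (y :* y)) ≈-refl

  i²*[r²*x]≈ir*[ir*x] : ∀ i r x → i ⊗ i ⊗ (r ⊗ r ⊗ x) ≈ i ⊗ r ⊗ (i ⊗ r ⊗ x)
  i²*[r²*x]≈ir*[ir*x] = solve 3 (λ i r x → i :* i :* (r :* r :* x) := i :* r :* (i :* r :* x)) ≈-refl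

  r*[mr*x]≈m*[r²*x] : ∀ r m x → r ⊗ (m ⊗ r ⊗ x) ≈ m ⊗ (r ⊗ r ⊗ x)
  r*[mr*x]≈m*[r²*x] = solve 3 (λ r m x → r :* (m :* r :* x) := m :* (r :* r :* x)) ≈-refl

  b*x+mb*x≈m*bx+bx : ∀ m b x → b ⊗ x ⊕ m ⊗ b ⊗ x ≈ m ⊗ (b ⊗ x) ⊕ b ⊗ x
  b*x+mb*x≈m*bx+bx = solve 3 (λ m b x → b :* x :+ m :* b :* x := m :* (b :* x) :+ b :* x) ≈-refl

  [x+my]*[x+y] : ∀ m x y → (x ⊕ m ⊗ y) ⊗ (x ⊕ y) ≈ m ⊗ (y ⊗ y) ⊕ x ⊗ x ⊕ (m ⊗ (x ⊗ y) ⊕ x ⊗ y)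
  [x+my]*[x+y] = solve 3 (λ m x y →
    (x :+ m :* y) :* (x :+ y) := m :* (y :* y) :+ x :* x :+ (m :* (x :* y) :+ x :* y)) ≈-refl

  two-term-identity : ∀ m x y → y ⊗ y ⊗ x ⊕ m ⊗ (x ⊗ y) ⊗ y ≈ m ⊗ (y ⊗ y ⊗ x) ⊕ y ⊗ y ⊗ x
  two-term-identity = solve 3 (λ m x y → y :* y :* x :+ m :* (x :* y) :* y := m :* (y :* y :* x) :+ y :* y :* x) ≈-refl

  -- Once n is `q + 1#`, the right side has the form `m ⊗ z ⊕ z`, which vanishes for m = -1.
  three-term-identity : ∀ m n q s t u →
    q ⊗ (n ⊗ (m ⊗ (s ⊗ t))) ⊗ (t ⊗ u ⊗ (t ⊗ u)) ⊗ s
    ⊕ (n ⊗ (s ⊗ t) ⊗ u ⊗ (n ⊗ (s ⊗ t) ⊗ u) ⊗ t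
    ⊕ n ⊗ (m ⊗ (t ⊗ u)) ⊗ (s ⊗ t ⊗ (s ⊗ t)) ⊗ u)
    ≈ m ⊗ (n ⊗ (q ⊕ 𝟙) ⊗ (s ⊗ t ⊗ (s ⊗ t) ⊗ (u ⊗ u) ⊗ t))
    ⊕ n ⊗ n ⊗ (s ⊗ t ⊗ (s ⊗ t) ⊗ (u ⊗ u) ⊗ t)
  three-term-identity = solve 6 (λ m n q s t u →
    q :* (n :* (m :* (s :* t))) :* (t :* u :* (t :* u)) :* s
    :+ (n :* (s :* t) :* u :* (n :* (s :* t) :* u) :* t
    :+ n :* (m :* (t :* u)) :* (s :* t :* (s :* t)) :* u)
    := m :* (n :* (q :+ con 1) :* (s :* t :* (s :* t) :* (u :* u) :* t))
    :+ n :* n :* (s :* t :* (s :* t) :* (u :* u) :* t)) ≈-refl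

  m*[b*d]+b*d≈b*d+b*[m*d] : ∀ m b d → m ⊗ (b ⊗ d) ⊕ b ⊗ d ≈ b ⊗ d ⊕ b ⊗ (m ⊗ d)
  m*[b*d]+b*d≈b*d+b*[m*d] = solve 3 (λ m b d → m :* (b :* d) :+ b :* d := b :* d :+ b :* (m :* d)) ≈-refl

-- The field of residues modulo p.

module Residues (p : ℕ) .{{_ : NonZero p}} (prime : Prime p) where

  private
    variable
      x y z : ℤ/ p

    0%p≡0 : 0 % p ≡ 0
    0%p≡0 = m<n⇒m%n≡m (ℕ.>-nonZero⁻¹ p)

  [_] : ℕ → ℤ/ p
  [ m ] = m mod p

  toℕ-[] : ∀ m → toℕ [ m ] ≡ m % p
  toℕ-[] m = Fin.toℕ-fromℕ< (m%n<n m p)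

  []-cong : ∀ {a b} → a % p ≡ b % p → [ a ] ≡ [ b ]
  []-cong {a} {b} eq = Fin.toℕ-injective (trans (toℕ-[] a) (trans eq (sym (toℕ-[] b))))

  [toℕ] : ∀ x → [ toℕ x ] ≡ x
  [toℕ] x = Fin.toℕ-injective (trans (toℕ-[] (toℕ x)) (m<n⇒m%n≡m (Fin.toℕ<n x)))

  -- Together with `[]-*` and `[toℕ]` this transfers the semiring laws from ℕ: an argument is first
  -- rewritten as the class of its representative.
  []-+ : ∀ a b → [ a ] + [ b ] ≡ [ a ℕ.+ b ]
  []-+ a b = []-cong (trans (cong₂ (λ u v → (u ℕ.+ v) % p) (toℕ-[] a) (toℕ-[] b))
                            (sym (%-distribˡ-+ a b p)))

  []-* : ∀ a b → [ a ] * [ b ] ≡ [ a ℕ.* b ]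
  []-* a b = []-cong (trans (cong₂ (λ u v → (u ℕ.* v) % p) (toℕ-[] a) (toℕ-[] b))
                            (sym (%-distribˡ-* a b p)))

  +-comm : ∀ x y → x + y ≡ y + x
  +-comm x y = cong [_] (ℕ.+-comm (toℕ x) (toℕ y))

  *-comm : ∀ x y → x * y ≡ y * x
  *-comm x y = cong [_] (ℕ.*-comm (toℕ x) (toℕ y))

  +-assoc : ∀ x y z → (x + y) + z ≡ x + (y + z)
  +-assoc x y z = begin
    (x + y) + z                       ≡⟨ cong ((x + y) +_) ([toℕ] z) ⟨
    (x + y) + [ toℕ z ]               ≡⟨ []-+ _ _ ⟩
    [ (toℕ x ℕ.+ toℕ y) ℕ.+ toℕ z ]   ≡⟨ cong [_] (ℕ.+-assoc (toℕ x) _ _) ⟩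
    [ toℕ x ℕ.+ (toℕ y ℕ.+ toℕ z) ]   ≡⟨ []-+ _ _ ⟨
    [ toℕ x ] + (y + z)               ≡⟨ cong (_+ (y + z)) ([toℕ] x) ⟩
    x + (y + z)                       ∎
    where open ≡-Reasoning

  *-assoc : ∀ x y z → (x * y) * z ≡ x * (y * z)
  *-assoc x y z = begin
    (x * y) * z                       ≡⟨ cong ((x * y) *_) ([toℕ] z) ⟨
    (x * y) * [ toℕ z ]               ≡⟨ []-* _ _ ⟩
    [ (toℕ x ℕ.* toℕ y) ℕ.* toℕ z ]   ≡⟨ cong [_] (ℕ.*-assoc (toℕ x) _ _) ⟩
    [ toℕ x ℕ.* (toℕ y ℕ.* toℕ z) ]   ≡⟨ []-* _ _ ⟨
    [ toℕ x ] * (y * z)               ≡⟨ cong (_* (y * z)) ([toℕ] x) ⟩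
    x * (y * z)                       ∎
    where open ≡-Reasoning

  +-identityˡ : ∀ x → 0# + x ≡ x
  +-identityˡ x = trans (cong (0# +_) (sym ([toℕ] x))) (trans ([]-+ 0 (toℕ x)) ([toℕ] x))

  *-identityˡ : ∀ x → 1# * x ≡ x
  *-identityˡ x = begin
    1# * x             ≡⟨ cong (1# *_) ([toℕ] x) ⟨
    1# * [ toℕ x ]     ≡⟨ []-* 1 (toℕ x) ⟩
    [ 1 ℕ.* toℕ x ]    ≡⟨ cong [_] (ℕ.*-identityˡ (toℕ x)) ⟩
    [ toℕ x ]          ≡⟨ [toℕ] x ⟩
    x                  ∎
    where open ≡-Reasoning

  *-distribʳ-+ : ∀ x y z → (y + z) * x ≡ y * x + z * x
  *-distribʳ-+ x y z = begin
    (y + z) * x                                     ≡⟨ cong ((y + z) *_) ([toℕ] x) ⟨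
    (y + z) * [ toℕ x ]                             ≡⟨ []-* _ _ ⟩
    [ (toℕ y ℕ.+ toℕ z) ℕ.* toℕ x ]                 ≡⟨ cong [_] (ℕ.*-distribʳ-+ (toℕ x) (toℕ y) (toℕ z)) ⟩
    [ toℕ y ℕ.* toℕ x ℕ.+ toℕ z ℕ.* toℕ x ]         ≡⟨ []-+ _ _ ⟨
    y * x + z * x                                   ∎
    where open ≡-Reasoning

  +-*-commutativeSemiring : CommutativeSemiring 0ℓ 0ℓ
  +-*-commutativeSemiring = record
    { Carrier = ℤ/ p ; _≈_ = _≡_ ; _+_ = _+_ ; _*_ = _*_ ; 0# = 0# ; 1# = 1#
    ; isCommutativeSemiring = isCommutativeSemiringˡ record
      { +-isCommutativeMonoid = record
        { isMonoid = record
          { isSemigroup = record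
            { isMagma = isMagma _+_
            ; assoc = +-assoc }
          ; identity = +-identityˡ , λ x → trans (+-comm x 0#) (+-identityˡ x) }
        ; comm = +-comm }
      ; *-isCommutativeMonoid = record
        { isMonoid = record
          { isSemigroup = record
            { isMagma = isMagma _*_
            ; assoc = *-assoc }
          ; identity = *-identityˡ , λ x → trans (*-comm x 1#) (*-identityˡ x) }
        ; comm = *-comm }
      ; distribʳ = *-distribʳ-+
      ; zeroˡ = λ x → trans (cong (0# *_) (sym ([toℕ] x))) ([]-* 0 (toℕ x)) } }

  open CommutativeSemiring +-*-commutativeSemiring public
    using (zeroˡ; zeroʳ; +-identityʳ; *-identityʳ; distribˡ)
  open Exp +-*-commutativeSemiring public using (_^_; ^-distrib-*)
  open Identities +-*-commutativeSemiring

  -- Negation is multiplication by this element throughout, so that semiring identities with a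
  -- variable m in its place apply.
  -1# : ℤ/ p
  -1# = [ ℕ.pred p ]

  -1+1≡0 : -1# + 1# ≡ 0#
  -1+1≡0 = begin
    -1# + 1#               ≡⟨ []-+ (ℕ.pred p) 1 ⟩
    [ ℕ.pred p ℕ.+ 1 ]     ≡⟨ cong [_] (trans (ℕ.+-comm (ℕ.pred p) 1) (ℕ.suc-pred p)) ⟩
    [ p ]                  ≡⟨ []-cong (trans (n%n≡0 p) (sym 0%p≡0)) ⟩
    0#                     ∎
    where open ≡-Reasoning

  -1*x+x≡0 : ∀ x → -1# * x + x ≡ 0#
  -1*x+x≡0 x = begin
    -1# * x + x        ≡⟨ m*x+x≈[m+1]*x -1# x ⟩
    (-1# + 1#) * x     ≡⟨ cong (_* x) -1+1≡0 ⟩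
    0# * x             ≡⟨ zeroˡ x ⟩
    0#                 ∎
    where open ≡-Reasoning

  +-cancelˡ : ∀ x → x + y ≡ x + z → y ≡ z
  +-cancelˡ {y} {z} x eq = trans (sym (undo y)) (trans (cong (-1# * x +_) eq) (undo z))
    where
    undo : ∀ w → -1# * x + (x + w) ≡ w
    undo w = trans (sym (+-assoc _ x w)) (trans (cong (_+ w) (-1*x+x≡0 x)) (+-identityˡ w))

  toℕ≡0⇒≡0 : toℕ x ≡ 0 → x ≡ 0#
  toℕ≡0⇒≡0 {x} eq = trans (sym ([toℕ] x)) (cong [_] eq)

  []-nonZero : ∀ {m} → suc m < p → [ suc m ] ≢ 0#
  []-nonZero {m} m+1<p eq with trans (sym (m<n⇒m%n≡m m+1<p))
                            (trans (sym (toℕ-[] (suc m))) (trans (cong toℕ eq) (trans (toℕ-[] 0) 0%p≡0)))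
  ... | ()

  -- Euclid's lemma applies to the representatives, and a representative below p that p divides is
  -- zero.
  x*y≡0⇒x≡0⊎y≡0 : ∀ x y → x * y ≡ 0# → x ≡ 0# ⊎ y ≡ 0#
  x*y≡0⇒x≡0⊎y≡0 x y eq = Sum.map (vanish x) (vanish y)
    (euclidsLemma (toℕ x) (toℕ y) prime
      (m%n≡0⇒n∣m _ p (trans (sym (toℕ-[] _)) (trans (cong toℕ eq) (trans (toℕ-[] 0) 0%p≡0)))))
    where
    vanish : ∀ x → p ∣ toℕ x → x ≡ 0#
    vanish x p∣x with toℕ x ℕ.≟ 0
    ... | yes x≡0 = toℕ≡0⇒≡0 x≡0
    ... | no  x≢0 = contradiction p∣x (>⇒∤ {{ℕ.≢-nonZero x≢0}} (Fin.toℕ<n x))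

  *-nonZero : x ≢ 0# → y ≢ 0# → x * y ≢ 0#
  *-nonZero x≢0 y≢0 eq = [ x≢0 , y≢0 ]′ (x*y≡0⇒x≡0⊎y≡0 _ _ eq)

  private
    ap≡0 : ∀ a → [ a ℕ.* p ] ≡ 0#
    ap≡0 a = []-cong (trans (m*n%n≡0 a p) (sym 0%p≡0))

  abstract
    -- Bézout's identity over ℕ comes with two signs: 1 + b x = a p gives the inverse -b, and 1 + a
    -- p = b x gives b.
    inverse : ∀ x → x ≢ 0# → ∃ λ i → i * x ≡ 1#
    inverse x x≢0
      with coprime-Bézout (prime⇒coprime prime {{ℕ.≢-nonZero (x≢0 ∘ toℕ≡0⇒≡0)}} (Fin.toℕ<n x))
    ... | Bézout.+- a b eq = -1# * [ b ] ,
      trans (cong (λ y → -1# * [ b ] * y) (sym ([toℕ] x))) (+-cancelˡ [ b ℕ.* toℕ x ] (begin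
      [ b ℕ.* toℕ x ] + -1# * [ b ] * [ toℕ x ]     ≡⟨ cong (_+ -1# * [ b ] * [ toℕ x ]) ([]-* b (toℕ x)) ⟨
      [ b ] * [ toℕ x ] + -1# * [ b ] * [ toℕ x ]   ≡⟨ b*x+mb*x≈m*bx+bx -1# [ b ] [ toℕ x ] ⟩
      -1# * ([ b ] * [ toℕ x ]) + [ b ] * [ toℕ x ] ≡⟨ -1*x+x≡0 _ ⟩
      0#                                            ≡⟨ ap≡0 a ⟨
      [ a ℕ.* p ]                                   ≡⟨ cong [_] eq ⟨
      [ 1 ℕ.+ b ℕ.* toℕ x ]                         ≡⟨ []-+ 1 _ ⟨
      1# + [ b ℕ.* toℕ x ]                          ≡⟨ +-comm 1# _ ⟩
      [ b ℕ.* toℕ x ] + 1#                          ∎))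
      where open ≡-Reasoning
    ... | Bézout.-+ a b eq = [ b ] , (begin
      [ b ] * x          ≡⟨ cong ([ b ] *_) ([toℕ] x) ⟨
      [ b ] * [ toℕ x ]  ≡⟨ []-* b (toℕ x) ⟩
      [ b ℕ.* toℕ x ]    ≡⟨ cong [_] eq ⟨
      [ 1 ℕ.+ a ℕ.* p ]  ≡⟨ []-+ 1 _ ⟨
      1# + [ a ℕ.* p ]   ≡⟨ cong (1# +_) (ap≡0 a) ⟩
      1# + 0#            ≡⟨ +-identityʳ 1# ⟩
      1#                 ∎)
      where open ≡-Reasoning

  1≢0 : 1# ≢ 0#
  1≢0 = []-nonZero (ℕ.nonTrivial⇒n>1 p {{prime⇒nonTrivial prime}})

  *-cancelˡ : ∀ x → x ≢ 0# → x * y ≡ x * z → y ≡ z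
  *-cancelˡ {y} {z} x x≢0 eq with i , ix≡1 ← inverse x x≢0 =
    trans (sym (undo y)) (trans (cong (i *_) eq) (undo z))
    where
    undo : ∀ w → i * (x * w) ≡ w
    undo w = trans (sym (*-assoc i x w)) (trans (cong (_* w) ix≡1) (*-identityˡ w))

  nonZero⇒unit : x ≢ 0# → Unit p x
  nonZero⇒unit x≢0 with i , ix≡1 ← inverse _ x≢0 = i , ix≡1 , trans (*-comm _ i) ix≡1

  unit⇒nonZero : Unit p x → x ≢ 0#
  unit⇒nonZero (i , ix≡1 , _) refl = 1≢0 (trans (sym ix≡1) (zeroʳ i))

  -- Non-zero squares.

  Q-square : x ≢ 0# → Q p (x * x)
  Q-square x≢0 = _ , nonZero⇒unit x≢0 , refl

  Q⇒nonZero : Q p x → x ≢ 0#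
  Q⇒nonZero (r , r-unit , refl) = *-nonZero (unit⇒nonZero r-unit) (unit⇒nonZero r-unit)

  Q-1 : Q p 1#
  Q-1 = subst (Q p) (*-identityˡ 1#) (Q-square 1≢0)

  Q-* : Q p x → Q p y → Q p (x * y)
  Q-* (r , r-unit , refl) (s , s-unit , refl) =
    subst (Q p) ([x*y]²≈x²*y² r s)
      (Q-square (*-nonZero (unit⇒nonZero r-unit) (unit⇒nonZero s-unit)))

  -- If r is a root of x and i is its inverse, then multiplying x y by i² leaves y.
  Q-cancelˡ : Q p x → Q p (x * y) → Q p y
  Q-cancelˡ {y = y} (r , (i , ir≡1 , _) , refl) Qxy = subst (Q p) i²r²y≡y (Q-* (Q-square i≢0) Qxy)
    where
    i≢0 : i ≢ 0#
    i≢0 refl = 1≢0 (trans (sym ir≡1) (zeroˡ r))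
    i²r²y≡y : i * i * (r * r * y) ≡ y
    i²r²y≡y = begin
      i * i * (r * r * y)      ≡⟨ i²*[r²*x]≈ir*[ir*x] i r y ⟩
      i * r * (i * r * y)      ≡⟨ cong (λ w → w * (w * y)) ir≡1 ⟩
      1# * (1# * y)            ≡⟨ trans (*-identityˡ _) (*-identityˡ y) ⟩
      y                        ∎
      where open ≡-Reasoning

  abstract
    -- A search through all possible roots; being a unit is traded for the decidable condition of
    -- being non-zero.
    Q? : Decidable (Q p)
    Q? y = map′ (λ (x , x≢0 , eq) → x , nonZero⇒unit x≢0 , eq)
                (λ (x , x-unit , eq) → x , unit⇒nonZero x-unit , eq)
                (Fin.any? λ x → ¬? (x Fin.≟ 0#) ×-dec (y Fin.≟ x * x))

  -- Products of lists that split into pairs.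

  product : List (ℤ/ p) → ℤ/ p
  product = foldr _*_ 1#

  product-↭ : ∀ {xs ys} → xs ↭ ys → product xs ≡ product ys
  product-↭ σ = Permutation.foldr-commMonoid (setoid (ℤ/ p))
    (CommutativeSemiring.*-isCommutativeMonoid +-*-commutativeSemiring) (↭⇒↭ₛ σ)

  Unique-resp-↭ : ∀ {xs ys : List (ℤ/ p)} → xs ↭ ys → Unique xs → Unique ys
  Unique-resp-↭ σ = Permutation.Unique-resp-↭ (setoid (ℤ/ p)) (↭⇒↭ₛ σ)

  -- The partners are unique by cancellation, so deleting a pair from xs keeps the rest closed under
  -- taking partners.
  product-pairing : ∀ k {c xs} → length xs ≡ k ℕ.* 2 → Unique xs → (∀ {x} → x ∈ xs → x ≢ 0#) →
                    (∀ {x} → x ∈ xs → ∃ λ y → y ∈ xs × y ≢ x × x * y ≡ c) →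
                    product xs ≡ c ^ k
  product-pairing zero {xs = []} _ _ _ _ = refl
  product-pairing (suc k) {c} {x ∷ xs} len (x# ∷ u) nonZero partner
    with partner (here refl)
  ... | y , here y≡x , y≢x , _ = contradiction y≡x y≢x
  ... | y , there y∈xs , y≢x , xy≡c
    with ys , σ ← extract y∈xs
    with y# ∷ u′ ← Unique-resp-↭ σ u = begin
      x * product xs         ≡⟨ cong (x *_) (product-↭ σ) ⟩
      x * (y * product ys)   ≡⟨ *-assoc x y _ ⟨
      x * y * product ys     ≡⟨ cong₂ _*_ xy≡c (product-pairing k len′ u′ nonZero′ partner′) ⟩
      c * c ^ k              ∎
    where
    open ≡-Reasoning
    len′ : length ys ≡ k ℕ.* 2
    len′ = ℕ.suc-injective (trans (sym (↭-length σ)) (ℕ.suc-injective len))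
    back : ∀ {z} → z ∈ ys → z ∈ xs
    back z∈ys = ∈-resp-↭ (↭-sym σ) (there z∈ys)
    nonZero′ : ∀ {z} → z ∈ ys → z ≢ 0#
    nonZero′ z∈ys = nonZero (there (back z∈ys))
    partner′ : ∀ {z} → z ∈ ys → ∃ λ w → w ∈ ys × w ≢ z × z * w ≡ c
    partner′ {z} z∈ys with partner (there (back z∈ys))
    ... | _ , here refl , _ , zx≡c =
      contradiction (*-cancelˡ x (nonZero (here refl)) (trans xy≡c (trans (sym zx≡c) (*-comm z x))))
                    (ListAll.lookup y# z∈ys)
    ... | w , there w∈xs , w≢z , zw≡c with ∈-resp-↭ σ w∈xs
    ...   | there w∈ys = w , w∈ys , w≢z , zw≡c
    ...   | here refl =
      contradiction (*-cancelˡ y (nonZero (there y∈xs))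
                      (trans (*-comm y x) (trans xy≡c (trans (sym zw≡c) (*-comm z y)))))
                    (ListAll.lookup x# (back z∈ys))

  -- Division, signs, and cancellation of two values.

  abstract
    divide : ∀ {c} → c ≢ 0# → x ≢ 0# → ∃ λ y → y ≢ 0# × x * y ≡ c
    divide {x} {c} c≢0 x≢0 with i , ix≡1 ← inverse x x≢0 = i * c , y≢0 , xy≡c
      where
      xy≡c : x * (i * c) ≡ c
      xy≡c = begin
        x * (i * c)  ≡⟨ x*[i*y]≈i*x*y x i c ⟩
        i * x * c    ≡⟨ cong (_* c) ix≡1 ⟩
        1# * c       ≡⟨ *-identityˡ c ⟩
        c            ∎
        where open ≡-Reasoning
      y≢0 : i * c ≢ 0#
      y≢0 eq = c≢0 (trans (sym xy≡c) (trans (cong (x *_) eq) (zeroʳ x)))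

  -1*-1≡1 : -1# * -1# ≡ 1#
  -1*-1≡1 = +-cancelˡ -1# (trans (+-comm -1# _) (trans (-1*x+x≡0 -1#) (sym -1+1≡0)))

  -1≢0 : -1# ≢ 0#
  -1≢0 eq = 1≢0 (trans (sym -1*-1≡1) (trans (cong (_* -1#) eq) (zeroˡ -1#)))

  -x*-x≡x² : ∀ x → -1# * x * (-1# * x) ≡ x * x
  -x*-x≡x² x = begin
    -1# * x * (-1# * x)   ≡⟨ [x*y]²≈x²*y² -1# x ⟩
    -1# * -1# * (x * x)   ≡⟨ cong (_* (x * x)) -1*-1≡1 ⟩
    1# * (x * x)          ≡⟨ *-identityˡ _ ⟩
    x * x                 ∎
    where open ≡-Reasoning

  -- The product (x - y)(x + y) vanishes, hence so does a factor.
  x²≡y²⇒x≡±y : x * x ≡ y * y → x ≡ y ⊎ x ≡ -1# * y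
  x²≡y²⇒x≡±y {x} {y} x²≡y² = Sum.map
    (λ eq → +-cancelˡ (-1# * y) (trans (+-comm _ x) (trans eq (sym (-1*x+x≡0 y)))))
    (λ eq → +-cancelˡ y (trans (+-comm y x) (trans eq (trans (sym (-1*x+x≡0 y)) (+-comm _ y)))))
    (x*y≡0⇒x≡0⊎y≡0 (x + -1# * y) (x + y) (begin
      (x + -1# * y) * (x + y)                              ≡⟨ [x+my]*[x+y] -1# x y ⟩
      -1# * (y * y) + x * x + (-1# * (x * y) + x * y)      ≡⟨ cong₂ (λ v w → -1# * (y * y) + v + w) x²≡y² (-1*x+x≡0 (x * y)) ⟩
      -1# * (y * y) + y * y + 0#                           ≡⟨ +-identityʳ _ ⟩
      -1# * (y * y) + y * y                                ≡⟨ -1*x+x≡0 _ ⟩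
      0#                                                   ∎))
    where open ≡-Reasoning

  -- The weights y² and -xy balance, since y² x - (x y) y = 0; the second is a square by hypothesis.
  two-term : y ≢ 0# → Q p (-1# * (x * y)) → ∃₂ λ a b → Q p a × Q p b × a * x + b * y ≡ 0#
  two-term {y} {x} y≢0 Q-xy = y * y , -1# * (x * y) , Q-square y≢0 , Q-xy , (begin
    y * y * x + -1# * (x * y) * y     ≡⟨ two-term-identity -1# x y ⟩
    -1# * (y * y * x) + y * y * x     ≡⟨ -1*x+x≡0 _ ⟩
    0#                                ∎)
    where open ≡-Reasoning

  -- Values of weighted sums whose weights have sum zero.

  dot : ∀ {m} → Vec (ℤ/ p) m → Vec (ℤ/ p) m → ℤ/ p
  dot as xs = sum (zipWith _*_ as xs)

  sum-++ : ∀ {l m} (xs : Vec (ℤ/ p) l) (ys : Vec (ℤ/ p) m) → sum (xs Vec.++ ys) ≡ sum xs + sum ys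
  sum-++ []       ys = sym (+-identityˡ (sum ys))
  sum-++ (x ∷ xs) ys = trans (cong (x +_) (sum-++ xs ys)) (sym (+-assoc x (sum xs) (sum ys)))

  dot-++ : ∀ {l m} (as xs : Vec (ℤ/ p) l) (bs ys : Vec (ℤ/ p) m) →
           dot (as Vec.++ bs) (xs Vec.++ ys) ≡ dot as xs + dot bs ys
  dot-++ []       []       bs ys = sym (+-identityˡ (dot bs ys))
  dot-++ (a ∷ as) (x ∷ xs) bs ys =
    trans (cong (a * x +_) (dot-++ as xs bs ys)) (sym (+-assoc (a * x) (dot as xs) (dot bs ys)))

  sum-scale : ∀ {m} c (xs : Vec (ℤ/ p) m) → sum (Vec.map (c *_) xs) ≡ c * sum xs
  sum-scale c []       = sym (zeroʳ c)
  sum-scale c (x ∷ xs) = trans (cong (c * x +_) (sum-scale c xs)) (sym (distribˡ c x (sum xs)))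

  dot-scale : ∀ {m} c (as xs : Vec (ℤ/ p) m) → dot (Vec.map (c *_) as) xs ≡ c * dot as xs
  dot-scale c []       []       = sym (zeroʳ c)
  dot-scale c (a ∷ as) (x ∷ xs) =
    trans (cong₂ _+_ (*-assoc c a x) (dot-scale c as xs)) (sym (distribˡ c (a * x) (dot as xs)))

  dot-replicate : ∀ {m} b (as : Vec (ℤ/ p) m) → dot (replicate m b) as ≡ b * sum as
  dot-replicate b []       = sym (zeroʳ b)
  dot-replicate b (a ∷ as) =
    trans (cong (b * a +_) (dot-replicate b as)) (sym (distribˡ b a (sum as)))

  -- Weights of sum zero meet the second condition of a weighted zero-sum with any constant choice b
  -- from B, so B need not be mentioned here. Concatenation adds represented values, and scaling by
  -- a square keeps the weights in `Q p`.
  Represents : ∀ {m} → Vec (ℤ/ p) m → ℤ/ p → Set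
  Represents {m} xs s = Σ[ as ∈ Vec (ℤ/ p) m ] All (Q p) as × sum as ≡ 0# × dot as xs ≡ s

  represents-++ : ∀ {l m s t} {xs : Vec (ℤ/ p) l} {ys : Vec (ℤ/ p) m} →
                  Represents xs s → Represents ys t → Represents (xs Vec.++ ys) (s + t)
  represents-++ {xs = xs} {ys} (as , Qas , Σas≡0 , as·xs≡s) (bs , Qbs , Σbs≡0 , bs·ys≡t) =
    as Vec.++ bs , ++⁺ Qas Qbs ,
    trans (sum-++ as bs) (trans (cong₂ _+_ Σas≡0 Σbs≡0) (+-identityˡ 0#)) ,
    trans (dot-++ as xs bs ys) (cong₂ _+_ as·xs≡s bs·ys≡t)

  represents-scale : ∀ {m c s} {xs : Vec (ℤ/ p) m} → Q p c → Represents xs s → Represents xs (c * s)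
  represents-scale {c = c} {xs = xs} Qc (as , Qas , Σas≡0 , as·xs≡s) =
    Vec.map (c *_) as , map⁺ (VecAll.map (Q-* Qc) Qas) ,
    trans (sum-scale c as) (trans (cong (c *_) Σas≡0) (zeroʳ c)) ,
    trans (dot-scale c as xs) (cong (c *_) as·xs≡s)

  represents⇒weightedZeroSum : ∀ {ℓ} {B : Pred (ℤ/ p) ℓ} {m} {xs : Vec (ℤ/ p) m} → Satisfiable B →
                               Represents xs 0# → WeightedZeroSum (Q p) B xs
  represents⇒weightedZeroSum {m = m} (b , Bb) (as , Qas , Σas≡0 , as·xs≡0) =
    as , replicate m b , Qas , all-replicate m Bb , as·xs≡0 ,
    trans (dot-replicate b as) (trans (cong (b *_) Σas≡0) (zeroʳ b))

  -- The lower bound: windows of a barrier sequence.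

  -- `V` is an arbitrary predicate because for the tail starting at d the exact form b d of the sums
  -- is needed, to exclude cancellation against the earlier entry 1.
  PrefixDots : ∀ {r} → Vec (ℤ/ p) r → Pred (ℤ/ p) 0ℓ → Set
  PrefixDots R V = ∀ {m} (ys as : Vec (ℤ/ p) (suc m)) → Prefix _≡_ (toList ys) (toList R) →
                   All (Q p) as → V (dot as ys)

  prefixDots-[] : ∀ {V} → PrefixDots [] V
  prefixDots-[] (y ∷ ys) as ()

  -- Zeros contribute nothing: a prefix that ends among them has sum zero and at most j terms, and a
  -- longer one has the sum of its remainder, a non-empty prefix of R.
  prefixDots-zeros : ∀ {r V} {R : Vec (ℤ/ p) r} → PrefixDots R V → ∀ j {m} (ys as : Vec (ℤ/ p) m) →
                     Prefix _≡_ (toList ys) (toList (replicate j 0# Vec.++ R)) → All (Q p) as →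
                     (m ≤ j × dot as ys ≡ 0#) ⊎ V (dot as ys)
  prefixDots-zeros dots j []                 []       pre Qas = inj₁ (z≤n , refl)
  prefixDots-zeros dots zero    ys@(_ ∷ _)   as       pre Qas = inj₂ (dots ys as pre Qas)
  prefixDots-zeros {V = V} dots (suc j) (y ∷ ys) (a ∷ as) (y≡0 ∷ pre) (_ ∷ Qas) =
    Sum.map (λ (m≤j , eq) → s≤s m≤j , trans skip eq) (subst V (sym skip))
      (prefixDots-zeros {V = V} dots j ys as pre Qas)
    where
    skip : a * y + dot as ys ≡ dot as ys
    skip = trans (cong (λ y → a * y + dot as ys) y≡0)
      (trans (cong (_+ dot as ys) (zeroʳ a)) (+-identityˡ (dot as ys)))

  -- Windows of at most k terms are exempt, since they may consist of zeros; they are excluded later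
  -- through the sum of the bᵢ aᵢ.
  Avoids : ∀ {r} → ℕ → Vec (ℤ/ p) r → Set
  Avoids k R = ∀ {m} (ys as : Vec (ℤ/ p) m) → Infix _≡_ (toList ys) (toList R) →
               All (Q p) as → m ≤ k ⊎ dot as ys ≢ 0#

  avoids-[] : ∀ {k} → Avoids k []
  avoids-[] []       as _           Qas = inj₁ z≤n
  avoids-[] (_ ∷ _)  as (here ())   Qas

  avoids-∷ : ∀ {k r x} {R : Vec (ℤ/ p) r} → PrefixDots (x ∷ R) (_≢ 0#) → Avoids k R → Avoids k (x ∷ R)
  avoids-∷ dots avoids []         as inf         Qas = inj₁ z≤n
  avoids-∷ dots avoids ys@(_ ∷ _) as (here pre)  Qas = inj₂ (dots ys as pre Qas)
  avoids-∷ dots avoids ys@(_ ∷ _) as (there inf) Qas = avoids ys as inf Qas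

  avoids-zeros : ∀ {k r} {R : Vec (ℤ/ p) r} → PrefixDots R (_≢ 0#) → Avoids k R →
                 ∀ j → j ≤ k → Avoids k (replicate j 0# Vec.++ R)
  avoids-zeros dots avoids zero    j≤k = avoids
  avoids-zeros dots avoids (suc j) j<k ys as (here pre)  Qas =
    Sum.map₁ (λ (m≤j , _) → ℕ.≤-trans m≤j j<k) (prefixDots-zeros {V = _≢ 0#} dots (suc j) ys as pre Qas)
  avoids-zeros dots avoids (suc j) j<k ys as (there inf) Qas =
    avoids-zeros dots avoids j (ℕ.<⇒≤ j<k) ys as inf Qas

  -- The final `[]` lets the last run of zeros be treated by the same lemmas as the other two.
  barrier : ∀ k d → Vec (ℤ/ p) (k ℕ.+ suc (k ℕ.+ suc (k ℕ.+ 0)))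
  barrier k d = replicate k 0# Vec.++ (1# ∷ (replicate k 0# Vec.++ (d ∷ (replicate k 0# Vec.++ []))))

  -- A window that meets a non-zero entry has sum a, b d or a + b d with squares a and b. The first
  -- two are non-zero, and a + b d = 0 would make -d = a / b a square.
  avoids-barrier : ∀ k d → d ≢ 0# → ¬ Q p (-1# * d) → Avoids k (barrier k d)
  avoids-barrier k d d≢0 ¬Q-d =
    avoids-zeros dots₁ (avoids-∷ dots₁ (avoids-zeros dots₂′ (avoids-∷ dots₂′
      (avoids-zeros (prefixDots-[] {_≢ 0#}) avoids-[] k ℕ.≤-refl)) k ℕ.≤-refl)) k ℕ.≤-refl
    where
    dots₂ : PrefixDots (d ∷ (replicate k 0# Vec.++ [])) (λ v → ∃ λ b → Q p b × v ≡ b * d)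
    dots₂ (y ∷ ys) (a ∷ as) (y≡d ∷ pre) (Qa ∷ Qas)
      -- Nothing follows the last zeros, so `V` can be empty and only the first alternative remains.
      with prefixDots-zeros {V = λ _ → ⊥} (prefixDots-[] {λ _ → ⊥}) k ys as pre Qas
    ... | inj₁ (_ , eq) = a , Qa , trans (cong₂ (λ y v → a * y + v) y≡d eq) (+-identityʳ (a * d))
    dots₂′ : PrefixDots (d ∷ (replicate k 0# Vec.++ [])) (_≢ 0#)
    dots₂′ ys as pre Qas eq = let b , Qb , v≡bd = dots₂ ys as pre Qas in
      *-nonZero (Q⇒nonZero Qb) d≢0 (trans (sym v≡bd) eq)
    dots₁ : PrefixDots (1# ∷ (replicate k 0# Vec.++ (d ∷ (replicate k 0# Vec.++ [])))) (_≢ 0#)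
    dots₁ (y ∷ ys) (a ∷ as) (y≡1 ∷ pre) (Qa ∷ Qas) = [ alone , together ]′
      (prefixDots-zeros {V = λ v → ∃ λ b → Q p b × v ≡ b * d} dots₂ k ys as pre Qas)
      where
      a+_≢0 : ∀ {v} w → v ≡ w → a + w ≢ 0# → a * y + v ≢ 0#
      a+_≢0 w v≡w a+w≢0 eq = a+w≢0 (trans
        (cong₂ _+_ (sym (trans (cong (a *_) y≡1) (*-identityʳ a))) (sym v≡w)) eq)
      alone : ∀ {m} → m × dot as ys ≡ 0# → a * y + dot as ys ≢ 0#
      alone (_ , v≡0) = a+_≢0 0# v≡0 (Q⇒nonZero Qa ∘ trans (sym (+-identityʳ a)))
      together : (∃ λ b → Q p b × dot as ys ≡ b * d) → a * y + dot as ys ≢ 0#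
      together (b , Qb , v≡bd) = a+_≢0 (b * d) v≡bd λ a+bd≡0 →
        ¬Q-d (Q-cancelˡ {b} { -1# * d} Qb (subst (Q p) (a≡b[-d] a+bd≡0) Qa))
        where
        a≡b[-d] : a + b * d ≡ 0# → a ≡ b * (-1# * d)
        a≡b[-d] eq = +-cancelˡ (b * d) (begin
          b * d + a                 ≡⟨ +-comm (b * d) a ⟩
          a + b * d                 ≡⟨ eq ⟩
          0#                        ≡⟨ -1*x+x≡0 (b * d) ⟨
          -1# * (b * d) + b * d     ≡⟨ m*[b*d]+b*d≈b*d+b*[m*d] -1# b d ⟩
          b * d + b * (-1# * d)     ∎)
          where open ≡-Reasoning

  -- For m ≤ 3k + 2 the first m terms of the barrier are a counterexample: windows of more than k
  -- terms have a non-zero weighted sum, and `short` excludes the others.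
  Forces-bound : ∀ {ℓ} {B : Pred (ℤ/ p) ℓ} k d → d ≢ 0# → ¬ Q p (-1# * d) →
    (∀ {m} (as bs : Vec (ℤ/ p) (suc m)) → suc m ≤ k → All (Q p) as → All B bs → dot bs as ≢ 0#) →
    ∀ m → Forces (Q p) B m → suc k ℕ.+ (suc k ℕ.+ suc k) ≤ m
  Forces-bound {B = B} k d d≢0 ¬Q-d short m forces with suc k ℕ.+ (suc k ℕ.+ suc k) ℕ.≤? m
  ... | yes 3k+3≤m = 3k+3≤m
  ... | no 3k+3≰m = ⊥-elim (refute (forces (truncate m≤len (barrier k d))))
    where
    m≤len : m ≤ k ℕ.+ suc (k ℕ.+ suc (k ℕ.+ 0))
    m≤len = subst (λ l → m ≤ k ℕ.+ suc (k ℕ.+ suc l)) (sym (ℕ.+-identityʳ k)) (ℕ.s≤s⁻¹ (ℕ.≰⇒> 3k+3≰m))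
    refute : ¬ HasConsecutiveZeroSum (Q p) B (truncate m≤len (barrier k d))
    -- The pattern `suc l` is where the window has to be non-empty.
    refute (suc l , ys , _ , inf , as , bs , Qas , Bbs , as·ys≡0 , bs·as≡0)
      with avoids-barrier k d d≢0 ¬Q-d ys as (Infix-Prefix-trans trans inf (prefix-truncate m≤len (barrier k d))) Qas
    ... | inj₁ l<k = short as bs l<k Qas Bbs bs·as≡0
    ... | inj₂ ≢0  = ≢0 as·ys≡0

  -- Wilson's theorem and Euler's criterion.

  module OddPrime (k : ℕ) (odd : p ≡ 1 ℕ.+ suc k ℕ.* 2) where

    -- This is (p - 1) / 2, the number of pairs of units; as a successor it leaves k pairs once r
    -- and -r are removed.
    half : ℕ
    half = suc k

    private
      toℕ-unit : ∀ {i} → i < half ℕ.* 2 → toℕ [ suc i ] ≡ suc i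
      toℕ-unit i< = trans (toℕ-[] _) (m<n⇒m%n≡m (subst (_ <_) (sym odd) (s≤s i<)))

    abstract
      units : List (ℤ/ p)
      units = applyUpTo ([_] ∘ suc) (half ℕ.* 2)

      length-units : length units ≡ half ℕ.* 2
      length-units = length-applyUpTo ([_] ∘ suc) (half ℕ.* 2)

      units-unique : Unique units
      units-unique = applyUpTo⁺₁ _ _ λ i<j j<2h eq →
        ℕ.<⇒≢ i<j (ℕ.suc-injective (trans (sym (toℕ-unit (ℕ.<-trans i<j j<2h)))
                                            (trans (cong toℕ eq) (toℕ-unit j<2h))))

      ∈units⇒nonZero : x ∈ units → x ≢ 0#
      ∈units⇒nonZero x∈ eq with i , i< , refl ← ∈-applyUpTo⁻ ([_] ∘ suc) x∈
        = []-nonZero (subst (_ <_) (sym odd) (s≤s i<)) eq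

      nonZero⇒∈units : x ≢ 0# → x ∈ units
      nonZero⇒∈units {x} x≢0 = by (toℕ x) refl
        where
        by : ∀ i → toℕ x ≡ i → x ∈ units
        by zero    eq = contradiction (toℕ≡0⇒≡0 eq) x≢0
        by (suc i) eq = subst (_∈ units) (trans (cong [_] (sym eq)) ([toℕ] x))
          (∈-applyUpTo⁺ ([_] ∘ suc) (ℕ.s≤s⁻¹ (subst₂ _<_ eq odd (Fin.toℕ<n x))))

    x+x≢0 : x ≢ 0# → x + x ≢ 0#
    x+x≢0 {x} x≢0 eq = *-nonZero 2≢0 x≢0 (trans
      (sym (x+x≈2*x x)) eq)
      where
      2≢0 : 1# + 1# ≢ 0#
      -- The form of p in `odd` shows 2 < p.
      2≢0 2≡0 = []-nonZero (subst (2 <_) (sym odd) (s≤s (s≤s (s≤s z≤n)))) (trans (sym ([]-+ 1 1)) 2≡0)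

    -x≢x : x ≢ 0# → -1# * x ≢ x
    -x≢x {x} x≢0 eq = x+x≢0 x≢0 (trans (cong (_+ x) (sym eq)) (-1*x+x≡0 x))

    -- Each unit x is paired with c / x; a unit paired with itself would be a root of c.
    product-units-nonresidue : x ≢ 0# → ¬ Q p x → product units ≡ x ^ half
    product-units-nonresidue {c} c≢0 ¬Qc =
      product-pairing half length-units units-unique ∈units⇒nonZero partner
      where
      partner : ∀ {x} → x ∈ units → ∃ λ y → y ∈ units × y ≢ x × x * y ≡ c
      partner {x} x∈ = let y , y≢0 , xy≡c = divide c≢0 (∈units⇒nonZero x∈) in
        y , nonZero⇒∈units y≢0 ,
        (λ y≡x → ¬Qc (subst (Q p) (trans (cong (x *_) (sym y≡x)) xy≡c) (Q-square {x} (∈units⇒nonZero x∈)))) ,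
        xy≡c

    -- The only units fixed by z ↦ r² / z are r and -r, so the remaining ones form k pairs of
    -- product r².
    product-without-±r : ∀ r {zs} → r ≢ 0# → units ↭ r ∷ -1# * r ∷ zs → product zs ≡ (r * r) ^ k
    product-without-±r r {zs} r≢0 σ with Unique-resp-↭ σ units-unique
    ... | (_ ∷ r#) ∷ -r# ∷ u = product-pairing k len u nonZero partner
      where
      len : length zs ≡ k ℕ.* 2
      len = ℕ.suc-injective (ℕ.suc-injective (trans (sym (↭-length σ)) length-units))
      nonZero : ∀ {z} → z ∈ zs → z ≢ 0#
      nonZero z∈zs = ∈units⇒nonZero (∈-resp-↭ (↭-sym σ) (there (there z∈zs)))
      partner : ∀ {z} → z ∈ zs → ∃ λ w → w ∈ zs × w ≢ z × z * w ≡ r * r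
      partner {z} z∈zs = let w , w≢0 , zw≡r² = divide (*-nonZero r≢0 r≢0) (nonZero z∈zs) in
        w , w∈zs w zw≡r² (∈-resp-↭ σ (nonZero⇒∈units w≢0)) , w≢z w zw≡r² , zw≡r²
        where
        z≢r : z ≢ r
        z≢r z≡r = ListAll.lookup r# z∈zs (sym z≡r)
        z≢-r : z ≢ -1# * r
        z≢-r z≡-r = ListAll.lookup -r# z∈zs (sym z≡-r)
        w≢z : ∀ w → z * w ≡ r * r → w ≢ z
        w≢z w zw≡r² w≡z = [ z≢r , z≢-r ]′ (x²≡y²⇒x≡±y (trans (cong (z *_) (sym w≡z)) zw≡r²))
        w∈zs : ∀ w → z * w ≡ r * r → w ∈ r ∷ -1# * r ∷ zs → w ∈ zs
        w∈zs w zw≡r² (here w≡r) = contradiction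
          (*-cancelˡ r r≢0 (trans (*-comm r z) (trans (cong (z *_) (sym w≡r)) zw≡r²))) z≢r
        w∈zs w zw≡r² (there (here w≡-r)) = contradiction
          (*-cancelˡ (-1# * r) (*-nonZero -1≢0 r≢0)
            (trans (*-comm (-1# * r) z) (trans (cong (z *_) (sym w≡-r)) (trans zw≡r² (sym (-x*-x≡x² r)))))) z≢-r
        w∈zs w zw≡r² (there (there w∈)) = w∈

    extract-±r : ∀ r → r ≢ 0# → ∃ λ zs → units ↭ r ∷ -1# * r ∷ zs
    extract-±r r r≢0 = let ys , σ = extract (nonZero⇒∈units r≢0) in
      go ys σ (∈-resp-↭ σ (nonZero⇒∈units (*-nonZero -1≢0 r≢0)))
      where
      go : ∀ ys → units ↭ r ∷ ys → -1# * r ∈ r ∷ ys → ∃ λ zs → units ↭ r ∷ -1# * r ∷ zs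
      go ys σ (here -r≡r) = contradiction -r≡r (-x≢x {r} r≢0)
      go ys σ (there -r∈ys) = let zs , τ = extract -r∈ys in zs , ↭-trans σ (prep r τ)

    -- The removed r and -r contribute -r², and the k pairs contribute r² each.
    product-units-residue : ∀ r → r ≢ 0# → product units ≡ -1# * (r * r) ^ half
    product-units-residue r r≢0 = let zs , σ = extract-±r r r≢0 in go zs σ
      where
      open ≡-Reasoning
      go : ∀ zs → units ↭ r ∷ -1# * r ∷ zs → product units ≡ -1# * (r * r) ^ half
      go zs σ = begin
        product units                  ≡⟨ product-↭ σ ⟩
        r * (-1# * r * product zs)     ≡⟨ cong (λ w → r * (-1# * r * w)) (product-without-±r r r≢0 σ) ⟩
        r * (-1# * r * (r * r) ^ k)    ≡⟨ r*[mr*x]≈m*[r²*x] r -1# ((r * r) ^ k) ⟩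
        -1# * ((r * r) * (r * r) ^ k)  ∎

    1^m≡1 : ∀ m → 1# ^ m ≡ 1#
    1^m≡1 zero    = refl
    1^m≡1 (suc m) = trans (*-identityˡ _) (1^m≡1 m)

    wilson : product units ≡ -1#
    wilson = begin
      product units             ≡⟨ product-units-residue 1# 1≢0 ⟩
      -1# * (1# * 1#) ^ half    ≡⟨ cong (λ w → -1# * w ^ half) (*-identityˡ 1#) ⟩
      -1# * 1# ^ half           ≡⟨ cong (-1# *_) (1^m≡1 half) ⟩
      -1# * 1#                  ≡⟨ *-identityʳ -1# ⟩
      -1#                       ∎
      where open ≡-Reasoning

    -- Two evaluations of the product of all units are compared: the pairing for the nonresidue x,
    -- and `wilson`, which is the residue case r = 1.
    euler-nonresidue : x ≢ 0# → ¬ Q p x → x ^ half ≡ -1#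
    euler-nonresidue x≢0 ¬Qx = trans (sym (product-units-nonresidue x≢0 ¬Qx)) wilson

    euler-residue : Q p x → x ^ half ≡ 1#
    euler-residue (r , r-unit , refl) = *-cancelˡ -1# -1≢0
      (trans (sym (product-units-residue r (unit⇒nonZero r-unit)))
             (trans wilson (sym (*-identityʳ -1#))))

    -1≢1 : -1# ≢ 1#
    -1≢1 eq = -x≢x 1≢0 (trans (*-identityʳ -1#) eq)

    euler : x ≢ 0# → x ^ half ≡ 1# → Q p x
    euler {x} x≢0 eq with Q? x
    ... | yes Qx = Qx
    ... | no ¬Qx = contradiction (trans (sym (euler-nonresidue x≢0 ¬Qx)) eq) -1≢1

    -- By Euler's criterion this is (-1)(-1) = 1.
    nonresidue-* : x ≢ 0# → ¬ Q p x → y ≢ 0# → ¬ Q p y → Q p (x * y)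
    nonresidue-* {x} {y} x≢0 ¬Qx y≢0 ¬Qy = euler (*-nonZero x≢0 y≢0) (begin
      (x * y) ^ half          ≡⟨ ^-distrib-* x y half ⟩
      x ^ half * y ^ half     ≡⟨ cong₂ _*_ (euler-nonresidue x≢0 ¬Qx) (euler-nonresidue y≢0 ¬Qy) ⟩
      -1# * -1#               ≡⟨ -1*-1≡1 ⟩
      1#                      ∎)
      where open ≡-Reasoning

    [-1]^[j*2]≡1 : ∀ j → -1# ^ (j ℕ.* 2) ≡ 1#
    [-1]^[j*2]≡1 zero    = refl
    [-1]^[j*2]≡1 (suc j) = trans (sym (*-assoc -1# -1# _))
      (trans (cong₂ _*_ -1*-1≡1 ([-1]^[j*2]≡1 j)) (*-identityˡ 1#))

    -- Euler's criterion for -1 reads off the parity of `half`; the odd case follows in `¬Q-[-1]`.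
    Q-[-1] : ∀ j → half ≡ j ℕ.* 2 → Q p -1#
    Q-[-1] j half≡2j = euler -1≢0 (trans (cong (-1# ^_) half≡2j) ([-1]^[j*2]≡1 j))

    ¬Q-[-1] : ∀ j → half ≡ suc (j ℕ.* 2) → ¬ Q p -1#
    ¬Q-[-1] j half≡2j+1 Q-1 = -1≢1 (begin
      -1#                     ≡⟨ *-identityʳ -1# ⟨
      -1# * 1#                ≡⟨ cong (-1# *_) ([-1]^[j*2]≡1 j) ⟨
      -1# ^ suc (j ℕ.* 2)     ≡⟨ cong (-1# ^_) half≡2j+1 ⟨
      -1# ^ half              ≡⟨ euler-residue Q-1 ⟩
      1#                      ∎)
      where open ≡-Reasoning

    -- Nonresidues, and cancellation of three values.

    -- Otherwise a choice of square roots is an injection of ℤ/ p into itself that misses -√1.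
    ∃-nonresidue : ∃ λ x → x ≢ 0# × ¬ Q p x
    ∃-nonresidue with Fin.any? (λ x → ¬? (x Fin.≟ 0#) ×-dec ¬? (Q? x))
    ... | yes found = found
    ... | no ¬found = ⊥-elim (avoids⇒notInjective (-1# * √ 1#) avoids √-injective)
      where
      root : ∀ x → ∃ λ r → r * r ≡ x
      root x with x Fin.≟ 0# | Q? x
      ... | yes x≡0 | _                 = 0# , trans (zeroˡ 0#) (sym x≡0)
      ... | no _    | yes (r , _ , eq)  = r , sym eq
      ... | no x≢0  | no ¬Qx            = contradiction (x , x≢0 , ¬Qx) ¬found
      √ : ℤ/ p → ℤ/ p
      √ x = proj₁ (root x)
      √-square : ∀ x → √ x * √ x ≡ x
      √-square x = proj₂ (root x)
      √-injective : Injective _≡_ _≡_ √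
      √-injective {x} {y} eq = trans (sym (√-square x)) (trans (cong (λ r → r * r) eq) (√-square y))
      avoids : ∀ x → -1# * √ 1# ≢ √ x
      avoids x eq = -x≢x √1≢0 (trans eq (cong √ x≡1))
        where
        √1≢0 : √ 1# ≢ 0#
        √1≢0 √1≡0 = 1≢0 (trans (sym (√-square 1#)) (trans (cong (λ r → r * r) √1≡0) (zeroˡ 0#)))
        x≡1 : x ≡ 1#
        x≡1 = begin
          x                                ≡⟨ √-square x ⟨
          √ x * √ x                        ≡⟨ cong (λ r → r * r) eq ⟨
          -1# * √ 1# * (-1# * √ 1#)        ≡⟨ -x*-x≡x² (√ 1#) ⟩
          √ 1# * √ 1#                      ≡⟨ √-square 1# ⟩
          1#                               ∎
          where open ≡-Reasoning

    -- The first nonresidue in 1, 2, 3, … is preceded by a residue.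
    ∃-successor-nonresidue : ∃ λ x → Q p x × x + 1# ≢ 0# × ¬ Q p (x + 1#)
    ∃-successor-nonresidue = let x , x≢0 , ¬Qx = ∃-nonresidue in start x x≢0 ¬Qx (toℕ x) refl
      where
      successor : ∀ m → [ suc m ] ≡ [ m ] + 1#
      successor m = trans (cong [_] (ℕ.+-comm 1 m)) (sym ([]-+ m 1))
      descend : ∀ m → suc m < p → ¬ Q p [ suc m ] → ∃ λ x → Q p x × x + 1# ≢ 0# × ¬ Q p (x + 1#)
      descend zero    _     ¬Q1   = contradiction Q-1 ¬Q1
      descend (suc m) m+2<p ¬Qm+2 with Q? [ suc m ]
      ... | yes Qm+1 = [ suc m ] , Qm+1 , []-nonZero m+2<p ∘ trans (successor (suc m))
                     , ¬Qm+2 ∘ subst (Q p) (sym (successor (suc m)))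
      ... | no ¬Qm+1 = descend m (ℕ.<-trans (ℕ.n<1+n (suc m)) m+2<p) ¬Qm+1
      start : ∀ x → x ≢ 0# → ¬ Q p x → ∀ m → toℕ x ≡ m →
              ∃ λ x → Q p x × x + 1# ≢ 0# × ¬ Q p (x + 1#)
      start x x≢0 ¬Qx zero    eq = contradiction (toℕ≡0⇒≡0 eq) x≢0
      start x x≢0 ¬Qx (suc m) eq = descend m (subst (_< p) eq (Fin.toℕ<n x))
        (¬Qx ∘ subst (Q p) (trans (cong [_] (sym eq)) ([toℕ] x)))

    -- With n = q + 1 a nonresidue, a s + b t + c u is -n (q + 1) X + n² X for X = s²t³u²; a and c are
    -- squares because products of two nonresidues are.
    three-term : ∀ s t u → s ≢ 0# → t ≢ 0# → u ≢ 0# → ¬ Q p (-1# * (s * t)) → ¬ Q p (-1# * (t * u)) →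
                 ∃₂ λ a b → ∃ λ c → Q p a × Q p b × Q p c × a * s + (b * t + c * u) ≡ 0#
    three-term s t u s≢0 t≢0 u≢0 ¬Q-st ¬Q-tu with q , Qq , n≢0 , ¬Qn ← ∃-successor-nonresidue =
      let n   = q + 1#
          st≢0 = *-nonZero s≢0 t≢0
          tu≢0 = *-nonZero t≢0 u≢0
          X   = s * t * (s * t) * (u * u) * t
      in  q * (n * (-1# * (s * t))) * (t * u * (t * u))
        , n * (s * t) * u * (n * (s * t) * u)
        , n * (-1# * (t * u)) * (s * t * (s * t))
        , Q-* (Q-* Qq (nonresidue-* n≢0 ¬Qn (*-nonZero -1≢0 st≢0) ¬Q-st)) (Q-square tu≢0)
        , Q-square (*-nonZero (*-nonZero n≢0 st≢0) u≢0)
        , Q-* (nonresidue-* n≢0 ¬Qn (*-nonZero -1≢0 tu≢0) ¬Q-tu) (Q-square st≢0)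
        , trans (three-term-identity -1# n q s t u)
          (-1*x+x≡0 (n * n * X))

    two-term-or-three-term : ∀ s t u → s ≢ 0# → t ≢ 0# → u ≢ 0# →
      (∃₂ λ a b → Q p a × Q p b × a * s + b * t ≡ 0#) ⊎
      (∃₂ λ a b → Q p a × Q p b × a * t + b * u ≡ 0#) ⊎
      (∃₂ λ a b → ∃ λ c → Q p a × Q p b × Q p c × a * s + (b * t + c * u) ≡ 0#)
    two-term-or-three-term s t u s≢0 t≢0 u≢0 with Q? (-1# * (s * t)) | Q? (-1# * (t * u))
    ... | yes Q-st | _        = inj₁ (two-term t≢0 Q-st)
    ... | no _     | yes Q-tu = inj₂ (inj₁ (two-term u≢0 Q-tu))
    ... | no ¬Q-st | no ¬Q-tu = inj₂ (inj₂ (three-term s t u s≢0 t≢0 u≢0 ¬Q-st ¬Q-tu))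

    -- The upper bound and the values 6 and 9.

    -- The same w weighs all three blocks; scaled by squares, its copies on adjacent blocks join to
    -- weights in `Q p` that still have sum zero.
    forces-three-blocks : ∀ {ℓ} {B : Pred (ℤ/ p) ℓ} → Satisfiable B → ∀ k (w : Vec (ℤ/ p) (suc k)) →
      All (Q p) w → sum w ≡ 0# → Forces (Q p) B (suc k ℕ.+ (suc k ℕ.+ suc k))
    forces-three-blocks {B = B} satB k w Qw Σw≡0 xs =
      let X , YZ , eq  = Vec.splitAt (suc k) xs
          Y , Z  , eq′ = Vec.splitAt (suc k) YZ
      in  subst (HasConsecutiveZeroSum (Q p) B) (sym (trans eq (cong (X Vec.++_) eq′)))
            (blocks X Y Z (dot w X Fin.≟ 0#) (dot w Y Fin.≟ 0#) (dot w Z Fin.≟ 0#))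
      where
      represents : ∀ X → Represents X (dot w X)
      represents X = w , Qw , Σw≡0 , refl
      window : ∀ {m n s} {xs : Vec (ℤ/ p) n} (ys : Vec (ℤ/ p) (suc m)) → Infix _≡_ (toList ys) (toList xs) →
               Represents ys s → s ≡ 0# → HasConsecutiveZeroSum (Q p) B xs
      window ys ys≤xs rep s≡0 =
        _ , ys , s≤s z≤n , ys≤xs , represents⇒weightedZeroSum satB (subst (Represents ys) s≡0 rep)
      blocks : ∀ X Y Z → Dec (dot w X ≡ 0#) → Dec (dot w Y ≡ 0#) → Dec (dot w Z ≡ 0#) →
               HasConsecutiveZeroSum (Q p) B (X Vec.++ (Y Vec.++ Z))
      blocks X Y Z (yes s≡0) _ _ = window X (here (prefix-++ X (Y Vec.++ Z))) (represents X) s≡0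
      blocks X Y Z _ (yes t≡0) _ = window Y (infix-++ˡ X (here (prefix-++ Y Z))) (represents Y) t≡0
      blocks X Y Z _ _ (yes u≡0) =
        window Z (infix-++ˡ X (infix-++ˡ Y (infix-refl (toList Z)))) (represents Z) u≡0
      blocks X Y Z (no s≢0) (no t≢0) (no u≢0) = [ XY , [ YZ , XYZ ]′ ]′
        (two-term-or-three-term (dot w X) (dot w Y) (dot w Z) s≢0 t≢0 u≢0)
        where
        scaled : ∀ {a} X → Q p a → Represents X (a * dot w X)
        scaled X Qa = represents-scale Qa (represents X)
        XY : (∃₂ λ a b → Q p a × Q p b × a * dot w X + b * dot w Y ≡ 0#) → _
        XY (a , b , Qa , Qb , eq) = window (X Vec.++ Y) (here (prefix-++ˡ X (prefix-++ Y Z)))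
          (represents-++ (scaled X Qa) (scaled Y Qb)) eq
        YZ : (∃₂ λ a b → Q p a × Q p b × a * dot w Y + b * dot w Z ≡ 0#) → _
        YZ (a , b , Qa , Qb , eq) = window (Y Vec.++ Z) (infix-++ˡ X (infix-refl (toList (Y Vec.++ Z))))
          (represents-++ (scaled Y Qa) (scaled Z Qb)) eq
        XYZ : (∃₂ λ a b → ∃ λ c → Q p a × Q p b × Q p c ×
                a * dot w X + (b * dot w Y + c * dot w Z) ≡ 0#) → _
        XYZ (a , b , c , Qa , Qb , Qc , eq) = window (X Vec.++ (Y Vec.++ Z)) (infix-refl (toList (X Vec.++ (Y Vec.++ Z))))
          (represents-++ (scaled X Qa) (represents-++ (scaled Y Qb) (scaled Z Qc))) eq

    -- The vector w shows that k + 1 terms admit weights meeting the second condition, `short` that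
    -- fewer terms do not; the two bounds then meet at 3 (k + 1).
    C≡3k+3 : ∀ {ℓ} {B : Pred (ℤ/ p) ℓ} → Satisfiable B → ∀ k (w : Vec (ℤ/ p) (suc k)) →
      All (Q p) w → sum w ≡ 0# →
      (∀ {m} (as bs : Vec (ℤ/ p) (suc m)) → suc m ≤ k → All (Q p) as → All B bs → dot bs as ≢ 0#) →
      C⟨ Q p , B ⟩≡ (suc k ℕ.+ (suc k ℕ.+ suc k))
    C≡3k+3 satB k w Qw Σw≡0 short = let n , n≢0 , ¬Qn = ∃-nonresidue in
      s≤s z≤n , forces-three-blocks satB k w Qw Σw≡0 ,
      -- With d = -n, the element -d is the nonresidue n.
      λ m _ → Forces-bound k (-1# * n) (*-nonZero -1≢0 n≢0) (¬Qn ∘ subst (Q p) (-[-n]≡n n)) short m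
      where
      -[-n]≡n : ∀ n → -1# * (-1# * n) ≡ n
      -[-n]≡n n = trans (sym (*-assoc -1# -1# n)) (trans (cong (_* n) -1*-1≡1) (*-identityˡ n))

    C≡6 : ∀ {ℓ} {B : Pred (ℤ/ p) ℓ} → Satisfiable B → Q p -1# → 0# ∉ B → C⟨ Q p , B ⟩≡ 6
    C≡6 {B = B} satB Q-1# 0∉B = C≡3k+3 satB 1 (1# ∷ -1# ∷ []) (Q-1 ∷ Q-1# ∷ [])
      (trans (cong (1# +_) (+-identityʳ -1#)) (trans (+-comm 1# -1#) -1+1≡0)) short
      where
      short : ∀ {m} (as bs : Vec (ℤ/ p) (suc m)) → suc m ≤ 1 → All (Q p) as → All B bs → dot bs as ≢ 0#
      short (a ∷ []) (b ∷ []) _ (Qa ∷ []) (Bb ∷ []) eq =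
        *-nonZero (λ b≡0 → 0∉B (subst B b≡0 Bb)) (Q⇒nonZero Qa) (trans (sym (+-identityʳ (b * a))) eq)
      short (_ ∷ _ ∷ _) _ (s≤s ())

    C≡9 : ∀ {ℓ} {B : Pred (ℤ/ p) ℓ} → Satisfiable B → ¬ Q p -1# → B ⊆ Q p → C⟨ Q p , B ⟩≡ 9
    C≡9 {B = B} satB ¬Q-1# B⊆Q =
      -- At s = t = u = 1 both nonresidue hypotheses say that -1 is no square, and the result is
      -- three squares of sum zero.
      let a , b , c , Qa , Qb , Qc , eq = three-term 1# 1# 1# 1≢0 1≢0 1≢0 ¬Q-1*1 ¬Q-1*1
      in  C≡3k+3 satB 2 (a ∷ b ∷ c ∷ []) (Qa ∷ Qb ∷ Qc ∷ []) (trans (drop-1s a b c) eq) short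
      where
      ¬Q-1*1 : ¬ Q p (-1# * (1# * 1#))
      ¬Q-1*1 = ¬Q-1# ∘ subst (Q p) (trans (cong (-1# *_) (*-identityˡ 1#)) (*-identityʳ -1#))
      drop-1s : ∀ a b c → a + (b + (c + 0#)) ≡ a * 1# + (b * 1# + c * 1#)
      drop-1s a b c = sym (cong₂ _+_ (*-identityʳ a)
        (cong₂ _+_ (*-identityʳ b) (trans (*-identityʳ c) (sym (+-identityʳ c)))))
      short : ∀ {m} (as bs : Vec (ℤ/ p) (suc m)) → suc m ≤ 2 → All (Q p) as → All B bs → dot bs as ≢ 0#
      short (a ∷ []) (b ∷ []) _ (Qa ∷ []) (Bb ∷ []) eq =
        Q⇒nonZero (Q-* (B⊆Q Bb) Qa) (trans (sym (+-identityʳ (b * a))) eq)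
      short (a ∷ a′ ∷ []) (b ∷ b′ ∷ []) _ (Qa ∷ Qa′ ∷ []) (Bb ∷ Bb′ ∷ []) eq =
        -- Both b a and b′ a′ are squares; if their sum were zero, -1 would be their quotient and so
        -- a square.
        ¬Q-1# (Q-cancelˡ {u} { -1# } (Q-* (B⊆Q Bb) Qa) (subst (Q p) v≡u*-1 (Q-* (B⊆Q Bb′) Qa′)))
        where
        u v : ℤ/ p
        u = b * a
        v = b′ * a′
        v≡u*-1 : v ≡ u * -1#
        v≡u*-1 = +-cancelˡ u (begin
          u + v          ≡⟨ cong (u +_) (+-identityʳ v) ⟨
          u + (v + 0#)   ≡⟨ eq ⟩
          0#             ≡⟨ -1*x+x≡0 u ⟨
          -1# * u + u    ≡⟨ +-comm (-1# * u) u ⟩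
          u + -1# * u    ≡⟨ cong (u +_) (*-comm -1# u) ⟩
          u + u * -1#    ∎)
          where open ≡-Reasoning
      short (_ ∷ _ ∷ _ ∷ _) _ (s≤s (s≤s ()))

-- The two residue classes modulo 4.

theorem5p4 : (p : ℕ) .{{_ : NonZero p}} → Prime p → 2 ∤ p →
    {ℓ : Level} (B : Pred (ℤ/ p) ℓ) → Satisfiable B →
    (p % 4 ≡ 1 → 0# ∉ B → C⟨ Q p , B ⟩≡ 6) ×
    (p % 4 ≡ 3 → B ⊆ Q p → C⟨ Q p , B ⟩≡ 9)
theorem5p4 p p-prime _ B satB = part-i , part-ii
  where
  open Residues p p-prime
  decompose : ∀ {r} → p % 4 ≡ r → p ≡ r ℕ.+ p / 4 ℕ.* 4
  decompose eq = trans (m≡m%n+[m/n]*n p 4) (cong (ℕ._+ p / 4 ℕ.* 4) eq)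
  *4≡*2*2 : ∀ j → j ℕ.* 4 ≡ j ℕ.* 2 ℕ.* 2
  *4≡*2*2 j = sym (ℕ.*-assoc j 2 2)
  part-i : p % 4 ≡ 1 → 0# ∉ B → C⟨ Q p , B ⟩≡ 6
  part-i p%4≡1 0∉B = go (p / 4) (decompose p%4≡1)
    where
    go : ∀ j → p ≡ 1 ℕ.+ j ℕ.* 4 → C⟨ Q p , B ⟩≡ 6
    -- A zero quotient would give p = 1. For the quotient j + 1, `half` computes to (j + 1) * 2,
    -- which is even.
    go zero    p≡1 = contradiction p≡1 (ℕ.>⇒≢ (ℕ.nonTrivial⇒n>1 p {{prime⇒nonTrivial p-prime}}))
    go (suc j) eq = C≡6 satB (Q-[-1] (suc j) refl) 0∉B
      where open OddPrime (suc (j ℕ.* 2)) (trans eq (cong suc (*4≡*2*2 (suc j))))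
  part-ii : p % 4 ≡ 3 → B ⊆ Q p → C⟨ Q p , B ⟩≡ 9
  -- Here `half` is `suc (p / 4 * 2)`, visibly odd.
  part-ii p%4≡3 B⊆Q = C≡9 satB (¬Q-[-1] (p / 4) refl) B⊆Q
    where open OddPrime (p / 4 ℕ.* 2) (trans (decompose p%4≡3) (cong (3 ℕ.+_) (*4≡*2*2 (p / 4))))
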